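{- Let $(B_n)_{n\ge 0}$ be the sequence of rational numbers defined by $B_0=1$ and $\sum_{k=0}^{n-1}\binom{n}{k}B_k=0$ for all integers $n\ge 2$. Then for every integer $n\ge 1$, $$\sum_{k=0}^{n}\binom{n}{k}\frac{B_k}{n+2-k}=\frac{B_{n+1}}{n+1}.$$
   Context: The numbers $B_n$ are the Bernoulli numbers (with the convention $B_1=-\tfrac12$, as follows from the defining relation for $n=2$). -}

module Defs where

open import Algebra.Bundles using (CommutativeRing)
open import Data.Fin.Base using (toℕ)
open import Data.Integer.Base using (+_)
open import Data.Nat.Base using (ℕ; NonZero; _≥_)
open import Data.Nat.Combinatorics using (_C_)
open import Data.Rational.Base using (ℚ; 0ℚ; 1ℚ; _*_; _/_)
open import Data.Rational.Properties using (+-*-commutativeRing)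
open import Relation.Binary.PropositionalEquality.Core using (_≡_)

-- ∑[ i < n ] t and ∑[ i ≤ n ] t bind i : Fin n and i : Fin (suc n) respectively.
open import Algebra.Properties.Semiring.Sum
  (CommutativeRing.semiring +-*-commutativeRing) public
  using (sum; sum-syntax; sum⁺-syntax)

fromℕ : ℕ → ℚ
fromℕ n = + n / 1

infixl 7 _÷ℕ_

_÷ℕ_ : ℚ → (d : ℕ) .{{_ : NonZero d}} → ℚ
p ÷ℕ d = p * (+ 1 / d)

-- These conditions determine B uniquely: in the relation for n the last
-- summand is n B_{n-1}.  The case n = 2 gives B 1 = -1/2.
record IsBernoulli (B : ℕ → ℚ) : Set where
  field
    B₀≡1       : B 0 ≡ 1ℚ
    recurrence : ∀ n → n ≥ 2 →
                 ∑[ k < n ] (fromℕ (n C toℕ k) * B (toℕ k)) ≡ 0ℚ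

{-# OPTIONS --safe #-}
-- For k ≤ n, absorption gives
--   (n+2)(n+1) C(n,k) / (n+2-k) + C(n+2,k) = (n+2) C(n+1,k).
-- Summing against B_k over k ≤ n, the right side vanishes by the recurrence at
-- n+1, and the second sum on the left is -(n+2) B_{n+1} by the recurrence at n+2.
module Submission where

open import Defs
open import Algebra.Bundles using (CommutativeRing)
open import Data.Nat.Base using (ℕ; suc; _+_; _∸_; _≤_; _≥_; z≤n; s≤s; _!; NonZero)
import Data.Nat.Base as ℕ
import Data.Nat.DivMod as ℕ
import Data.Nat.Properties as ℕ
open import Data.Nat.Combinatorics
  using (_C_; nCk≡n!/k![n-k]!; k![n∸k]!∣n!; nCk≡nC[n∸k]; nC1≡n)
open import Data.Nat.Solver using () renaming (module +-*-Solver to ℕ-Solver)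
open import Data.Fin.Base using (Fin; toℕ)
open import Data.Fin.Properties using (toℕ-inject₁; toℕ-fromℕ; toℕ≤pred[n])
open import Data.Integer.Base using (+_)
import Data.Integer.Base as ℤ
import Data.Integer.Properties as ℤ
open import Data.Integer.Solver using () renaming (module +-*-Solver to ℤ-Solver)
open import Data.Rational.Base using (ℚ; _*_; 0ℚ; 1ℚ; _/_; fromℚᵘ)
import Data.Rational.Base as ℚ
import Data.Rational.Properties as ℚ
open import Data.Rational.Solver using () renaming (module +-*-Solver to ℚ-Solver)
open import Data.Rational.Unnormalised.Base using (mkℚᵘ; *≡*)
import Data.Rational.Unnormalised.Base as ℚᵘ
import Data.Rational.Unnormalised.Properties as ℚᵘ
open import Algebra.Properties.Group ℚ.+-0-group using (∙-cancelʳ)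
open import Algebra.Properties.Semiring.Sum
  (CommutativeRing.semiring ℚ.+-*-commutativeRing)
  using (sum-cong-≗; sum-init-last; ∑-distrib-+; *-distribˡ-sum)
open import Relation.Binary.PropositionalEquality.Core
  using (_≡_; refl; sym; trans; cong; cong₂)
open import Relation.Binary.PropositionalEquality.Properties using (module ≡-Reasoning)

open ≡-Reasoning

nCk*k![n∸k]!≡n! : ∀ {n k} → k ≤ n → (n C k) ℕ.* (k ! ℕ.* (n ∸ k) !) ≡ n !
nCk*k![n∸k]!≡n! {n} {k} k≤n = trans
  (cong (ℕ._* (k ! ℕ.* (n ∸ k) !)) (nCk≡n!/k![n-k]! k≤n))
  (ℕ.m/n*n≡m (k![n∸k]!∣n! k≤n))
  where instance _ = k ℕ.!* (n ∸ k) !≢0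

-- Absorption: multiplied by the nonzero `k ! * (n ∸ k) !`, both sides become `suc n !`.
[1+n∸k]*[1+n]Ck≡[1+n]*nCk : ∀ {n k} → k ≤ n →
  suc (n ∸ k) ℕ.* (suc n C k) ≡ suc n ℕ.* (n C k)
[1+n∸k]*[1+n]Ck≡[1+n]*nCk {n} {k} k≤n =
  ℕ.*-cancelʳ-≡ _ _ (k ! ℕ.* m !) (begin
    suc m ℕ.* (suc n C k) ℕ.* (k ! ℕ.* m !)
      ≡⟨ solve 4 (λ a b c d → a :* b :* (c :* d) := b :* (c :* (a :* d)))
               refl (suc m) (suc n C k) (k !) (m !) ⟩
    (suc n C k) ℕ.* (k ! ℕ.* suc m !)
      -- With truncated subtraction, `suc n ∸ k` is `suc (n ∸ k)` only because `k ≤ n`.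
      ≡⟨ cong (λ i → (suc n C k) ℕ.* (k ! ℕ.* i !)) (ℕ.+-∸-assoc 1 k≤n) ⟨
    (suc n C k) ℕ.* (k ! ℕ.* (suc n ∸ k) !)
      ≡⟨ nCk*k![n∸k]!≡n! (ℕ.m≤n⇒m≤1+n k≤n) ⟩
    suc n ℕ.* n !
      ≡⟨ cong (suc n ℕ.*_) (nCk*k![n∸k]!≡n! k≤n) ⟨
    suc n ℕ.* ((n C k) ℕ.* (k ! ℕ.* m !))
      ≡⟨ ℕ.*-assoc (suc n) (n C k) _ ⟨
    suc n ℕ.* (n C k) ℕ.* (k ! ℕ.* m !) ∎)
  where
  open ℕ-Solver
  m = n ∸ k
  instance _ = k ℕ.!* m !≢0

-- Absorption at `n` and at `suc n` turns both terms on the left into multiples of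
-- `(2 + n) * (suc n C k)`, with factors `d - 1` and `1`. Clearing the denominator `d` keeps the
-- identity in ℕ.
[2+n][1+n]nCk : ∀ {n k} → k ≤ n → let d = 2 + (n ∸ k) in
  (2 + n) ℕ.* (suc n ℕ.* (n C k)) + d ℕ.* ((2 + n) C k) ≡
  d ℕ.* ((2 + n) ℕ.* (suc n C k))
[2+n][1+n]nCk {n} {k} k≤n = begin
  (2 + n) ℕ.* (suc n ℕ.* (n C k)) + (2 + m) ℕ.* ((2 + n) C k)
    ≡⟨ cong₂ (λ x y → (2 + n) ℕ.* x + y)
         (sym ([1+n∸k]*[1+n]Ck≡[1+n]*nCk k≤n))
         (trans (cong (λ i → suc i ℕ.* ((2 + n) C k)) (sym (ℕ.+-∸-assoc 1 k≤n)))
                ([1+n∸k]*[1+n]Ck≡[1+n]*nCk (ℕ.m≤n⇒m≤1+n k≤n))) ⟩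
  (2 + n) ℕ.* (suc m ℕ.* b) + (2 + n) ℕ.* b
    ≡⟨ solve 3 (λ n m b →
         (con 2 :+ n) :* ((con 1 :+ m) :* b) :+ (con 2 :+ n) :* b :=
         (con 2 :+ m) :* ((con 2 :+ n) :* b)) refl n m b ⟩
  (2 + m) ℕ.* ((2 + n) ℕ.* b) ∎
  where
  open ℕ-Solver
  m = n ∸ k
  b = suc n C k

[1+n]Cn≡1+n : ∀ n → suc n C n ≡ suc n
[1+n]Cn≡1+n n = begin
  suc n C n           ≡⟨ nCk≡nC[n∸k] (ℕ.n≤1+n n) ⟩
  suc n C (suc n ∸ n) ≡⟨ cong (suc n C_) (ℕ.m+n∸n≡m 1 n) ⟩
  suc n C 1           ≡⟨ nC1≡n (suc n) ⟩
  suc n               ∎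

-- Sums in ℚ are normalised, so the comparison is made after `toℚᵘ`, which undoes `fromℚᵘ` up to
-- `≃`. As `fromℚᵘ (mkℚᵘ (+ n) 0)` unfolds to `fromℕ n`, facts about `fromℕ` reduce to integer
-- arithmetic.
fromℚᵘ-homo-+ : ∀ p q → fromℚᵘ (p ℚᵘ.+ q) ≡ fromℚᵘ p ℚ.+ fromℚᵘ q
fromℚᵘ-homo-+ p q = ℚ.toℚᵘ-injective (ℚᵘ.≃-trans (ℚ.toℚᵘ-fromℚᵘ (p ℚᵘ.+ q))
  (ℚᵘ.≃-sym (ℚᵘ.≃-trans (ℚ.toℚᵘ-homo-+ (fromℚᵘ p) (fromℚᵘ q))
    (ℚᵘ.+-cong (ℚ.toℚᵘ-fromℚᵘ p) (ℚ.toℚᵘ-fromℚᵘ q)))))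

fromℚᵘ-homo-* : ∀ p q → fromℚᵘ (p ℚᵘ.* q) ≡ fromℚᵘ p * fromℚᵘ q
fromℚᵘ-homo-* p q = ℚ.toℚᵘ-injective (ℚᵘ.≃-trans (ℚ.toℚᵘ-fromℚᵘ (p ℚᵘ.* q))
  (ℚᵘ.≃-sym (ℚᵘ.≃-trans (ℚ.toℚᵘ-homo-* (fromℚᵘ p) (fromℚᵘ q))
    (ℚᵘ.*-cong (ℚ.toℚᵘ-fromℚᵘ p) (ℚ.toℚᵘ-fromℚᵘ q)))))

fromℕ-homo-+ : ∀ m n → fromℕ (m + n) ≡ fromℕ m ℚ.+ fromℕ n
fromℕ-homo-+ m n = trans
  -- The unnormalised sum cross-multiplies, so its numerator is `m * 1 + n * 1`.
  (ℚ./-cong (sym (cong₂ ℤ._+_ (ℤ.*-identityʳ (+ m)) (ℤ.*-identityʳ (+ n)))) refl)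
  (fromℚᵘ-homo-+ (mkℚᵘ (+ m) 0) (mkℚᵘ (+ n) 0))

fromℕ-homo-* : ∀ m n → fromℕ (m ℕ.* n) ≡ fromℕ m * fromℕ n
fromℕ-homo-* m n = trans
  (ℚ./-cong (ℤ.pos-* m n) refl)
  (fromℚᵘ-homo-* (mkℚᵘ (+ m) 0) (mkℚᵘ (+ n) 0))

fromℕ-inverse : ∀ d .{{_ : NonZero d}} → fromℕ d * (+ 1 / d) ≡ 1ℚ
fromℕ-inverse d@(suc d-1) = trans
  (sym (fromℚᵘ-homo-* (mkℚᵘ (+ d) 0) (mkℚᵘ (+ 1) d-1)))
  (ℚ.fromℚᵘ-cong {mkℚᵘ (+ d) 0 ℚᵘ.* mkℚᵘ (+ 1) d-1} {mkℚᵘ (+ 1) 0}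
    (*≡* (solve 1 (λ x → x :* con (+ 1) :* con (+ 1) := con (+ 1) :* (con (+ 1) :* x))
                refl (+ d))))
  where open ℤ-Solver

fromℕ-*-÷ℕ : ∀ d .{{_ : NonZero d}} p → (fromℕ d * p) ÷ℕ d ≡ p
fromℕ-*-÷ℕ d p = begin
  fromℕ d * p * (+ 1 / d)   ≡⟨ solve 3 (λ x y z → x :* y :* z := x :* z :* y)
                                 refl (fromℕ d) p (+ 1 / d) ⟩
  fromℕ d * (+ 1 / d) * p   ≡⟨ cong (_* p) (fromℕ-inverse d) ⟩
  1ℚ * p                    ≡⟨ ℚ.*-identityˡ p ⟩
  p                         ∎
  where open ℚ-Solver

fromℕ-*-cancelˡ : ∀ d .{{_ : NonZero d}} {p q} → fromℕ d * p ≡ fromℕ d * q → p ≡ q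
fromℕ-*-cancelˡ d {p} {q} eq = begin
  p                  ≡⟨ fromℕ-*-÷ℕ d p ⟨
  (fromℕ d * p) ÷ℕ d ≡⟨ cong (_÷ℕ d) eq ⟩
  (fromℕ d * q) ÷ℕ d ≡⟨ fromℕ-*-÷ℕ d q ⟩
  q                  ∎

-- This is `[2+n][1+n]nCk` carried to ℚ, divided by `d` and multiplied by `x`, in the shape needed
-- for summing over `k`.
summand-identity : ∀ {n k} → k ≤ n → (x : ℚ) →
  fromℕ (2 + n) * (fromℕ (suc n) * (fromℕ (n C k) * (x ÷ℕ (2 + (n ∸ k)))))
    ℚ.+ fromℕ ((2 + n) C k) * x
  ≡ fromℕ (2 + n) * (fromℕ (suc n C k) * x)
summand-identity {n} {k} k≤n x = begin
  n₂ * (n₁ * (a * (x * δ⁻¹))) ℚ.+ c * x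
    -- Inserting `δ * δ⁻¹` into the second term lets `x * δ⁻¹` be factored out of both.
    ≡⟨ cong (λ y → n₂ * (n₁ * (a * (x * δ⁻¹))) ℚ.+ y) (fromℕ-*-÷ℕ d (c * x)) ⟨
  n₂ * (n₁ * (a * (x * δ⁻¹))) ℚ.+ δ * (c * x) * δ⁻¹
    ≡⟨ solve 7 (λ n₂ n₁ a x e d c →
         n₂ :* (n₁ :* (a :* (x :* e))) :+ d :* (c :* x) :* e :=
         (n₂ :* (n₁ :* a) :+ d :* c) :* x :* e) refl n₂ n₁ a x δ⁻¹ δ c ⟩
  (n₂ * (n₁ * a) ℚ.+ δ * c) * x * δ⁻¹
    ≡⟨ cong (λ y → y * x * δ⁻¹) coefficients ⟩
  δ * (n₂ * b) * x * δ⁻¹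
    ≡⟨ cong (_* δ⁻¹) (solve 4 (λ d n b x → d :* (n :* b) :* x := d :* (n :* (b :* x)))
                             refl δ n₂ b x) ⟩
  (δ * (n₂ * (b * x))) * δ⁻¹
    ≡⟨ fromℕ-*-÷ℕ d _ ⟩
  n₂ * (b * x) ∎
  where
  open ℚ-Solver
  d = 2 + (n ∸ k)
  δ = fromℕ d
  δ⁻¹ = + 1 / d
  n₂ = fromℕ (2 + n)
  n₁ = fromℕ (suc n)
  a = fromℕ (n C k)
  b = fromℕ (suc n C k)
  c = fromℕ ((2 + n) C k)

  fromℕ-*-* : ∀ i j l → fromℕ (i ℕ.* (j ℕ.* l)) ≡ fromℕ i * (fromℕ j * fromℕ l)
  fromℕ-*-* i j l = trans (fromℕ-homo-* i (j ℕ.* l)) (cong (fromℕ i *_) (fromℕ-homo-* j l))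

  coefficients : n₂ * (n₁ * a) ℚ.+ δ * c ≡ δ * (n₂ * b)
  coefficients = begin
    n₂ * (n₁ * a) ℚ.+ δ * c
      ≡⟨ cong₂ ℚ._+_ (fromℕ-*-* (2 + n) (suc n) (n C k)) (fromℕ-homo-* d ((2 + n) C k)) ⟨
    fromℕ ((2 + n) ℕ.* (suc n ℕ.* (n C k))) ℚ.+ fromℕ (d ℕ.* ((2 + n) C k))
      ≡⟨ fromℕ-homo-+ ((2 + n) ℕ.* (suc n ℕ.* (n C k))) (d ℕ.* ((2 + n) C k)) ⟨
    fromℕ ((2 + n) ℕ.* (suc n ℕ.* (n C k)) + d ℕ.* ((2 + n) C k))
      ≡⟨ cong fromℕ ([2+n][1+n]nCk k≤n) ⟩
    fromℕ (d ℕ.* ((2 + n) ℕ.* (suc n C k)))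
      ≡⟨ fromℕ-*-* d (2 + n) (suc n C k) ⟩
    δ * (n₂ * b) ∎

-- A summand that depends on its index only through `toℕ` does not see the `inject₁` and `fromℕ`
-- produced by splitting off the last index.
∑-init-last-toℕ : ∀ n (f : ℕ → ℚ) →
  ∑[ k ≤ n ] f (toℕ k) ≡ ∑[ k < n ] f (toℕ k) ℚ.+ f n
∑-init-last-toℕ n f = trans (sum-init-last {n} (λ k → f (toℕ k)))
  (cong₂ ℚ._+_ (sum-cong-≗ {n} (λ k → cong f (toℕ-inject₁ k))) (cong f (toℕ-fromℕ n)))

mainTheorem2 : (B : ℕ → ℚ) → IsBernoulli B → (n : ℕ) → n ≥ 1 →
    ∑[ k ≤ n ] (fromℕ (n C toℕ k) * (B (toℕ k) ÷ℕ (2 + (n ∸ toℕ k)))) ≡ B (suc n) ÷ℕ suc n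
mainTheorem2 B isB n n≥1 = begin
  S                  ≡⟨ fromℕ-*-÷ℕ (suc n) S ⟨
  (n₁ * S) ÷ℕ suc n  ≡⟨ cong (_÷ℕ suc n) (fromℕ-*-cancelˡ (2 + n) n₂n₁S≡n₂B) ⟩
  B (suc n) ÷ℕ suc n ∎
  where
  open IsBernoulli isB
  n₂ = fromℕ (2 + n)
  n₁ = fromℕ (suc n)

  s : Fin (suc n) → ℚ
  s k = fromℕ (n C toℕ k) * (B (toℕ k) ÷ℕ (2 + (n ∸ toℕ k)))

  -- Taking `k` in ℕ lets one summand serve both recurrences and be evaluated at the split-off index
  -- `suc n`.
  t : ℕ → ℕ → ℚ
  t m k = fromℕ (m C k) * B k

  S T : ℚ
  S = ∑[ k ≤ n ] s k
  T = ∑[ k ≤ n ] t (2 + n) (toℕ k)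

  n₂n₁S+T≡0 : n₂ * (n₁ * S) ℚ.+ T ≡ 0ℚ
  n₂n₁S+T≡0 = begin
    n₂ * (n₁ * S) ℚ.+ T
      ≡⟨ cong (λ y → n₂ * y ℚ.+ T) (*-distribˡ-sum n₁ s) ⟩
    n₂ * (∑[ k ≤ n ] (n₁ * s k)) ℚ.+ T
      ≡⟨ cong (ℚ._+ T) (*-distribˡ-sum n₂ (λ k → n₁ * s k)) ⟩
    ∑[ k ≤ n ] (n₂ * (n₁ * s k)) ℚ.+ T
      ≡⟨ ∑-distrib-+ (λ k → n₂ * (n₁ * s k)) (λ k → t (2 + n) (toℕ k)) ⟨
    ∑[ k ≤ n ] (n₂ * (n₁ * s k) ℚ.+ t (2 + n) (toℕ k))
      ≡⟨ sum-cong-≗ {suc n} (λ k → summand-identity {n} (toℕ≤pred[n] k) (B (toℕ k))) ⟩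
    ∑[ k ≤ n ] (n₂ * t (suc n) (toℕ k))
      ≡⟨ *-distribˡ-sum n₂ (λ (k : Fin (suc n)) → t (suc n) (toℕ k)) ⟨
    n₂ * (∑[ k ≤ n ] t (suc n) (toℕ k))
      -- The range `k < suc n` of this recurrence is exactly `k ≤ n`; its side condition `suc n ≥ 2`
      -- is where `n ≥ 1` enters.
      ≡⟨ cong (n₂ *_) (recurrence (suc n) (s≤s n≥1)) ⟩
    n₂ * 0ℚ
      ≡⟨ ℚ.*-zeroʳ n₂ ⟩
    0ℚ ∎

  -- The recurrence at `2 + n` runs one index beyond `T`, and that extra summand has coefficient
  -- `(2 + n) C suc n`, which is `2 + n`.
  T+n₂B≡0 : T ℚ.+ n₂ * B (suc n) ≡ 0ℚ
  T+n₂B≡0 = begin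
    T ℚ.+ n₂ * B (suc n)
      ≡⟨ cong (λ m → T ℚ.+ fromℕ m * B (suc n)) ([1+n]Cn≡1+n (suc n)) ⟨
    T ℚ.+ t (2 + n) (suc n)
      ≡⟨ ∑-init-last-toℕ (suc n) (t (2 + n)) ⟨
    ∑[ k ≤ suc n ] t (2 + n) (toℕ k)
      ≡⟨ recurrence (2 + n) (s≤s (s≤s z≤n)) ⟩
    0ℚ ∎

  n₂n₁S≡n₂B : n₂ * (n₁ * S) ≡ n₂ * B (suc n)
  -- Both sides are the additive inverse of `T`.
  n₂n₁S≡n₂B = ∙-cancelʳ T _ _
    (trans n₂n₁S+T≡0 (sym (trans (ℚ.+-comm (n₂ * B (suc n)) T) T+n₂B≡0)))
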